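{- Let $G$ be a simple graph of order $n$ and let $k$ be an integer with $0\le k\le n-1$. Then the number of vertices of $G$ of degree $k$ equals $[xy^{n-k}]\,da(G;x,y)$. Hence the degree sequence of $G$ is determined by $da(G;x,y)$.
   Context: All graphs are finite, simple and have at least one vertex. For a graph $G$, $S\subseteq V(G)$ and $u\in V(G)$, let $\bar S=V(G)\setminus S$, let $\delta_S(u)=|\{v\in S:\{u,v\}\in E(G)\}|$, and let $G[S]$ be the subgraph induced by $S$. The defensive alliance polynomial of $G$ is $$da(G;x,y)=\sum_{S} x^{|S|}\,y^{f_y(S)},\qquad f_y(S)=\min_{u\in S}\bigl(\delta_S(u)-\delta_{\bar S}(u)+|V(G)|\bigr),$$ where the sum runs over all non-empty $S\subseteq V(G)$ such that $G[S]$ is connected (single-vertex graphs are connected). $[x^ky^l]\,da(G;x,y)$ denotes the coefficient of $x^ky^l$ in $da(G;x,y)$. -}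

module Defs where

open import Data.Fin using (Fin)
open import Data.Fin.Properties using (any?; all?)
open import Data.Fin.Subset
  using (Subset; inside; outside; _∈_; _∉_; _⊃_; Nonempty; ∣_∣; _∩_; _∪_; ∁; ⁅_⁆)
open import Data.Fin.Subset.Induction using (⊃-wellFounded; Acc; acc)
open import Data.Fin.Subset.Properties
  using (_∈?_; nonempty?; x∈⁅x⁆; x∈⁅y⁆⇒x≡y; x∈p∪q⁻; x∈p∪q⁺; p⊆p∪q; ∣p∣≤n)
open import Data.Integer as ℤ using (+_)
open import Data.Integer.Properties using (⊖-≥; m-n≡m⊖n; +-assoc; +-comm)
open import Data.List using (List; []; _∷_; _++_; map; filter; length; allFin; foldr)
open import Data.List.Sort using (sort)
open import Data.Nat using (ℕ; zero; suc; _+_; _∸_; _⊓_)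
open import Data.Nat.ListAction using (sum)
open import Data.Nat.Properties using (_≟_; ≤-decTotalOrder; ≤-trans; m≤n+m)
open import Data.Product using (∃; _×_; _,_; proj₁)
open import Data.Sum using (inj₁; inj₂)
open import Data.Vec using ([]; _∷_; tabulate)
open import Data.Vec.Properties.WithK using ([]=-irrelevant)
open import Relation.Binary.Construct.Closure.ReflexiveTransitive
  using (Star; ε; _◅_; _◅◅_)
open import Relation.Binary.Construct.Flip.EqAndOrd using (decTotalOrder)
open import Relation.Binary.PropositionalEquality
  using (_≡_; refl; sym; trans; cong; subst)
open import Relation.Nullary using (¬_; Dec; yes; no; does; contradiction)
open import Relation.Nullary.Decidable using (_×-dec_; ¬?; map′; decidable-stable)

record SimpleGraph (V : Set) : Set₁ where
  field
    Adj        : V → V → Set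
    Adj?       : ∀ u v → Dec (Adj u v)
    Adj-sym    : ∀ {u v} → Adj u v → Adj v u
    Adj-irrefl : ∀ {v} → ¬ Adj v v

open SimpleGraph public

Graph : ℕ → Set₁
Graph n = SimpleGraph (Fin n)

Connected : ∀ {V} → SimpleGraph V → Set
Connected {V} G = ∀ (u v : V) → Star (Adj G) u v

induced : ∀ {n} → Graph n → (S : Subset n) → SimpleGraph (∃ λ v → v ∈ S)
induced G S = record
  { Adj        = λ (u , _) (v , _) → Adj G u v
  ; Adj?       = λ (u , _) (v , _) → Adj? G u v
  ; Adj-sym    = Adj-sym G
  ; Adj-irrefl = Adj-irrefl G
  }

-- Reachability in an induced subgraph is decided by growing the set T of
-- vertices known to be reachable from u until no edge leaves it.
module _ {n} (G : Graph n) (S : Subset n) where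

  private
    H = induced G S

    Exit : Subset n → Set
    Exit T = ∃ λ x → x ∈ T × ∃ λ y → y ∉ T × y ∈ S × Adj G x y

    exit? : ∀ T → Dec (Exit T)
    exit? T = any? λ x → x ∈? T ×-dec
      any? λ y → ¬? (y ∈? T) ×-dec (y ∈? S ×-dec Adj? G x y)

    closed : ∀ {T} → ¬ Exit T → ∀ {x y} → Star (Adj H) x y → proj₁ x ∈ T → proj₁ y ∈ T
    closed ¬e ε x∈T = x∈T
    closed {T} ¬e {x , _} (_◅_ {j = z , z∈S} e es) x∈T =
      closed ¬e es (decidable-stable (z ∈? T) λ z∉T → ¬e (x , x∈T , z , z∉T , z∈S , e))

    grow : ∀ u → (T : Subset n) → Acc _⊃_ T → proj₁ u ∈ T →
           (∀ x → proj₁ x ∈ T → Star (Adj H) u x) →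
           (∀ {x} → x ∈ T → x ∈ S) →
           ∀ v → Dec (Star (Adj H) u v)
    grow u T (acc rec) u∈T reach T⊆S v with exit? T
    ... | no ¬e = map′ (reach v) (λ p → closed ¬e p u∈T) (proj₁ v ∈? T)
    ... | yes (x , x∈T , y , y∉T , y∈S , e) =
      grow u (T ∪ ⁅ y ⁆)
        (rec (p⊆p∪q ⁅ y ⁆ , y , x∈p∪q⁺ (inj₂ (x∈⁅x⁆ y)) , y∉T))
        (p⊆p∪q ⁅ y ⁆ u∈T) reach′ T′⊆S v
      where
      reach-y : ∀ (q : y ∈ S) → Star (Adj H) u (y , q)
      reach-y q = reach (x , T⊆S x∈T) x∈T ◅◅ (e ◅ ε)

      reach′ : ∀ z → proj₁ z ∈ T ∪ ⁅ y ⁆ → Star (Adj H) u z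
      reach′ (z , z∈S) z∈ with x∈p∪q⁻ T ⁅ y ⁆ z∈
      ... | inj₁ z∈T = reach (z , z∈S) z∈T
      ... | inj₂ z∈y with refl ← x∈⁅y⁆⇒x≡y y z∈y = reach-y z∈S

      T′⊆S : ∀ {z} → z ∈ T ∪ ⁅ y ⁆ → z ∈ S
      T′⊆S z∈ with x∈p∪q⁻ T ⁅ y ⁆ z∈
      ... | inj₁ z∈T = T⊆S z∈T
      ... | inj₂ z∈y with refl ← x∈⁅y⁆⇒x≡y y z∈y = y∈S

    reachable? : ∀ u v → Dec (Star (Adj H) u v)
    reachable? u@(a , a∈S) = grow u ⁅ a ⁆ (⊃-wellFounded _) (x∈⁅x⁆ a) start
      (λ z∈ → subst (_∈ S) (sym (x∈⁅y⁆⇒x≡y a z∈)) a∈S)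
      where
      start : ∀ x → proj₁ x ∈ ⁅ a ⁆ → Star (Adj H) u x
      start (x , x∈S) x∈ with refl ← x∈⁅y⁆⇒x≡y a x∈
        with refl ← []=-irrelevant x∈S a∈S = ε

    ∀∈? : ∀ {P : (∃ λ v → v ∈ S) → Set} → (∀ x → Dec (P x)) → Dec (∀ x → P x)
    ∀∈? {P} P? = map′ (λ h (v , p) → h v p) (λ h v p → h (v , p)) (all? at)
      where
      at : ∀ v → Dec (∀ (p : v ∈ S) → P (v , p))
      at v with v ∈? S
      ... | no v∉S = yes λ p → contradiction p v∉S
      ... | yes p = map′ (λ h q → subst (λ r → P (v , r)) ([]=-irrelevant p q) h)
                         (λ h → h p) (P? (v , p))

  connected? : Dec (Connected H)
  connected? = ∀∈? λ u → ∀∈? (reachable? u)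

nbhd : ∀ {n} → Graph n → Fin n → Subset n
nbhd G u = tabulate λ v → does (Adj? G u v)

degree : ∀ {n} → Graph n → Fin n → ℕ
degree G u = ∣ nbhd G u ∣

numDegree : ∀ {n} → Graph n → ℕ → ℕ
numDegree G k = length (filter (λ v → degree G v ≟ k) (allFin _))

-- In nonincreasing order: the order passed to sort is the flipped one.
degreeSequence : ∀ {n} → Graph n → List ℕ
degreeSequence G = sort (decTotalOrder ≤-decTotalOrder) (map (degree G) (allFin _))

-- Polynomials in x and y with coefficients in ℕ, as formal sums of terms
-- c xᵏ yˡ. Exponent pairs may repeat, so polynomials are compared by _≈_.

record Term : Set where
  constructor _x^_y^_
  field
    coefficient xExponent yExponent : ℕ

open Term public

Polynomial : Set
Polynomial = List Term

coeff : ℕ → ℕ → Polynomial → ℕ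
coeff k l p = sum (map coefficient
  (filter (λ t → xExponent t ≟ k ×-dec yExponent t ≟ l) p))

infix 4 _≈_

_≈_ : Polynomial → Polynomial → Set
p ≈ q = ∀ k l → coeff k l p ≡ coeff k l q

subsets : ∀ n → List (Subset n)
subsets zero    = [] ∷ []
subsets (suc n) = map (outside ∷_) (subsets n) ++ map (inside ∷_) (subsets n)

δ : ∀ {n} → Graph n → Subset n → Fin n → ℕ
δ G S u = ∣ S ∩ nbhd G u ∣

score : ∀ {n} → Graph n → Subset n → Fin n → ℕ
score {n} G S u = (δ G S u + n) ∸ δ G (∁ S) u

-- The truncated subtraction in score never truncates.
score-exact : ∀ {n} (G : Graph n) S u →
  + score G S u ≡ (+ δ G S u ℤ.- + δ G (∁ S) u) ℤ.+ + n
score-exact {n} G S u = trans (sym (⊖-≥ (≤-trans (∣p∣≤n (∁ S ∩ nbhd G u)) (m≤n+m n a))))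
  (trans (sym (m-n≡m⊖n (a + n) b))
  (trans (+-assoc (+ a) (+ n) (ℤ.- + b))
  (trans (cong (λ z → + a ℤ.+ z) (+-comm (+ n) (ℤ.- + b)))
         (sym (+-assoc (+ a) (ℤ.- + b) (+ n))))))
  where
  a = δ G S u
  b = δ G (∁ S) u

-- The value at [] is a dummy: minimum is only used on nonempty lists.
minimum : List ℕ → ℕ
minimum []       = 0
minimum (x ∷ xs) = foldr _⊓_ x xs

f-y : ∀ {n} → Graph n → Subset n → ℕ
f-y G S = minimum (map (score G S) (filter (_∈? S) (allFin _)))

da : ∀ {n} → Graph n → Polynomial
da {n} G = map (λ S → 1 x^ ∣ S ∣ y^ f-y G S)
  (filter (λ S → nonempty? S ×-dec connected? G S) (subsets n))

{-# OPTIONS --safe #-}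
module Submission where

-- A singleton {v} is connected and, since v is not its own neighbour, its
-- score is n ∸ degree v. So the part of da G linear in x is Σᵥ x y^(n ∸ degree v).
-- As d ↦ n ∸ d is injective on d ≤ n, its coefficients count degrees; they also
-- determine the multiset of the codegrees n ∸ degree v, whose size is n, and
-- hence n and the degrees themselves.

open import Defs
open import Data.Bool using (true; false)
open import Data.Fin using (zero; suc)
open import Data.Fin.Subset
  using (Subset; inside; outside; _∈_; _∉_; _⊆_; ∣_∣; _∩_; ∁; ⁅_⁆; ⊥)
open import Data.Fin.Subset.Properties
  using (_∈?_; nonempty?; x∈⁅x⁆; x∈⁅y⁆⇒x≡y; x∉p⇒x∈∁p; x∈p∩q⁺; x∈p∩q⁻; p∩q⊆q;
         ⊆-antisym; Empty-unique; ∣p∣≤n; ∣⊥∣≡0)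
open import Data.List using (List; []; _∷_; _++_; [_]; map; filter; length; allFin; foldr)
import Data.List.Membership.Propositional as List
open import Data.List.Membership.Propositional.Properties
  using (∈-map⁺; ∈-filter⁺; ∈-filter⁻; ∈-allFin; ∈-∃++)
open import Data.List.Properties
  using (map-cong; map-∘; map-tabulate; length-map; length-tabulate;
         filter-++; filter-none; filter-some; filter-≐)
open import Data.List.Relation.Binary.Permutation.Propositional
  using (_↭_; ↭-refl; ↭-reflexive; ↭-sym; ↭-trans; prep; ↭⇒↭ₛ;
         module PermutationReasoning)
import Data.List.Relation.Binary.Permutation.Propositional.Properties as Perm
open import Data.List.Relation.Binary.Pointwise using (Pointwise-≡⇒≡)
open import Data.List.Relation.Unary.All as All using (All; []; _∷_)
import Data.List.Relation.Unary.All.Properties as All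
open import Data.List.Relation.Unary.Any using (here)
open import Data.List.Relation.Unary.Sorted.TotalOrder.Properties using (↗↭↗⇒≋)
import Data.List.Sort as Sort
open import Data.Nat using (ℕ; suc; _+_; _∸_; _⊓_; _≤_; _<_; NonZero)
open import Data.Nat.ListAction using (sum)
open import Data.Nat.Properties
  using (_≟_; suc-injective; ⊓-idem; <⇒≤; ∸-cancelˡ-≡; m∸[m∸n]≡n; ≤-decTotalOrder)
open import Data.Product using (∃; _×_; _,_)
open import Data.Vec using (_∷_)
open import Data.Vec.Properties using ([]=⇒lookup; lookup∘tabulate)
open import Data.Vec.Properties.WithK using ([]=-irrelevant)
open import Function using (_∘_; id)
open import Relation.Binary.Bundles using (module DecTotalOrder)
open import Relation.Binary.Construct.Closure.ReflexiveTransitive using (ε)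
import Relation.Binary.Construct.Flip.EqAndOrd as Flip
open import Relation.Binary.Definitions using (DecidableEquality)
open import Relation.Binary.PropositionalEquality
  using (_≡_; refl; sym; trans; cong; cong₂; subst; module ≡-Reasoning)
open import Relation.Nullary using (yes; no; does)
open import Relation.Nullary.Decidable using (_×-dec_)
open import Relation.Unary using (Decidable)

-- Filtering, counting and sorting lists.

module _ {A : Set} where

  filter-map : ∀ {B : Set} {P : B → Set} (P? : Decidable P) (f : A → B) xs →
    filter P? (map f xs) ≡ map f (filter (P? ∘ f) xs)
  filter-map P? f []       = refl
  filter-map P? f (x ∷ xs) with does (P? (f x))
  ... | true  = cong (f x ∷_) (filter-map P? f xs)
  ... | false = filter-map P? f xs

  filter-filter : ∀ {P Q : A → Set} (P? : Decidable P) (Q? : Decidable Q) xs →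
    filter P? (filter Q? xs) ≡ filter (λ x → Q? x ×-dec P? x) xs
  filter-filter P? Q? []       = refl
  filter-filter P? Q? (x ∷ xs) with does (Q? x)
  ... | false = filter-filter P? Q? xs
  ... | true with does (P? x)
  ...   | true  = cong (x ∷_) (filter-filter P? Q? xs)
  ...   | false = filter-filter P? Q? xs

  sum-map-1 : ∀ (xs : List A) → sum (map (λ _ → 1) xs) ≡ length xs
  sum-map-1 []       = refl
  sum-map-1 (_ ∷ xs) = cong suc (sum-map-1 xs)

module _ {A : Set} (_≟ᴬ_ : DecidableEquality A) where

  private
    count : A → List A → ℕ
    count a xs = length (filter (_≟ᴬ a) xs)

  -- Induction on `xs`: its head has positive multiplicity in `ys`, hence occurs there, and deleting
  -- one copy from each list keeps all multiplicities equal.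
  counts⇒↭ : ∀ xs ys → (∀ a → count a xs ≡ count a ys) → xs ↭ ys
  counts⇒↭ [] [] _ = ↭-refl
  counts⇒↭ [] (y ∷ ys) eq
    with () ← subst (0 <_) (sym (eq y)) (filter-some (_≟ᴬ y) {y ∷ ys} (here refl))
  counts⇒↭ (x ∷ xs) ys eq = split (∈-∃++ x∈ys)
    where
    occurs : ∀ zs → 0 < count x zs → x List.∈ zs
    -- A positive count leaves the filtered list a head, which lies in `zs` and passed the test of
    -- being equal to `x`.
    occurs zs 0<c with filter (_≟ᴬ x) zs in e
    ... | z ∷ _
      with z∈zs , refl ← ∈-filter⁻ (_≟ᴬ x) {xs = zs} (subst (z List.∈_) (sym e) (here refl))
      = z∈zs

    x∈ys : x List.∈ ys
    x∈ys = occurs ys (subst (0 <_) (eq x) (filter-some (_≟ᴬ x) {x ∷ xs} (here refl)))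

    split : (∃ λ us → ∃ λ vs → ys ≡ us ++ [ x ] ++ vs) → x ∷ xs ↭ ys
    split (us , vs , refl) = ↭-trans (prep x (counts⇒↭ xs (us ++ vs) eq′)) (↭-sym ys↭)
      where
      ys↭ : us ++ [ x ] ++ vs ↭ x ∷ us ++ vs
      ys↭ = Perm.shift x us vs

      eq′ : ∀ a → count a xs ≡ count a (us ++ vs)
      -- After the shift both lists start with `x`, so the single test of `x` against `a` decides
      -- whether both counts drop by one or neither does.
      eq′ a with e ← trans (eq a) (Perm.↭-length (Perm.filter-↭ (_≟ᴬ a) ys↭)) | does (x ≟ᴬ a)
      ... | true  = suc-injective e
      ... | false = e

-- Two sorted permutations of the same list agree entry by entry, because the order is total and
-- antisymmetric.
sort-cong : ∀ {xs ys : List ℕ} → xs ↭ ys →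
  let open Sort (Flip.decTotalOrder ≤-decTotalOrder) in sort xs ≡ sort ys
sort-cong {xs} {ys} xs↭ys = Pointwise-≡⇒≡
  (↗↭↗⇒≋ (DecTotalOrder.totalOrder O) (sort-↗ xs) (sort-↗ ys)
    (↭⇒↭ₛ (↭-trans (sort-↭ xs) (↭-trans xs↭ys (↭-sym (sort-↭ ys))))))
  where
  O = Flip.decTotalOrder ≤-decTotalOrder
  open Sort O

-- The membership premise excludes the empty list, where `minimum` takes its dummy value 0.
minimum-constant : ∀ {x} xs → All (_≡ x) xs → x List.∈ xs → minimum xs ≡ x
minimum-constant {x} (y ∷ ys) (refl ∷ ys≡x) _ = go ys≡x
  where
  go : ∀ {zs} → All (_≡ x) zs → foldr _⊓_ x zs ≡ x
  go []           = refl
  go (refl ∷ zs≡) = trans (cong (x ⊓_) (go zs≡)) (⊓-idem x)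

-- Subsets of size zero and one.

empties : ∀ n → filter (λ S → ∣ S ∣ ≟ 0) (subsets n) ≡ [ ⊥ ]
empties 0       = refl
empties (suc n) = begin
  filter P? (map (outside ∷_) Ss ++ map (inside ∷_) Ss)
    ≡⟨ filter-++ P? (map (outside ∷_) Ss) _ ⟩
  filter P? (map (outside ∷_) Ss) ++ filter P? (map (inside ∷_) Ss)
    ≡⟨ cong₂ _++_ (filter-map P? _ Ss) (filter-map P? _ Ss) ⟩
  map (outside ∷_) (filter (λ S → ∣ S ∣ ≟ 0) Ss) ++
  map (inside ∷_) (filter (λ S → suc ∣ S ∣ ≟ 0) Ss)
    ≡⟨ cong₂ (λ ps qs → map (outside ∷_) ps ++ map (inside ∷_) qs)
         (empties n) (filter-none (λ S → suc ∣ S ∣ ≟ 0) (All.universal (λ _ ()) Ss)) ⟩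
  [ ⊥ ] ∎
  where
  open ≡-Reasoning
  Ss = subsets n
  P? = λ (S : Subset (suc n)) → ∣ S ∣ ≟ 0

-- A one-element set containing `zero` is empty elsewhere, which is the case counted by `empties`;
-- the others come from the induction. Only a permutation holds: `subsets` puts the sets avoiding
-- `zero` first, while `allFin` starts with `zero`.
singletons : ∀ n → filter (λ S → ∣ S ∣ ≟ 1) (subsets n) ↭ map ⁅_⁆ (allFin n)
singletons 0       = ↭-refl
singletons (suc n) = begin
  filter P? (map (outside ∷_) Ss ++ map (inside ∷_) Ss)
    ≡⟨ filter-++ P? (map (outside ∷_) Ss) _ ⟩
  filter P? (map (outside ∷_) Ss) ++ filter P? (map (inside ∷_) Ss)
    ≡⟨ cong₂ _++_ (filter-map P? _ Ss) (filter-map P? _ Ss) ⟩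
  map (outside ∷_) (filter (λ S → ∣ S ∣ ≟ 1) Ss) ++
  map (inside ∷_) (filter (λ S → suc ∣ S ∣ ≟ 1) Ss)
    ≡⟨ cong (λ qs → map (outside ∷_) (filter (λ S → ∣ S ∣ ≟ 1) Ss) ++ map (inside ∷_) qs)
         (trans (filter-≐ (λ S → suc ∣ S ∣ ≟ 1) (λ S → ∣ S ∣ ≟ 0)
                   (suc-injective , cong suc) Ss) (empties n)) ⟩
  map (outside ∷_) (filter (λ S → ∣ S ∣ ≟ 1) Ss) ++ [ ⁅ zero ⁆ ]
    ↭⟨ Perm.++-comm _ [ ⁅ zero ⁆ ] ⟩
  ⁅ zero ⁆ ∷ map (outside ∷_) (filter (λ S → ∣ S ∣ ≟ 1) Ss)
    ↭⟨ prep _ (Perm.map⁺ (outside ∷_) (singletons n)) ⟩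
  ⁅ zero ⁆ ∷ map (outside ∷_) (map ⁅_⁆ (allFin n))
    -- `⁅ suc v ⁆` unfolds to `outside ∷ ⁅ v ⁆`, so both tails tabulate the same function.
    ≡⟨ cong (⁅ zero ⁆ ∷_) (trans (sym (map-∘ (allFin n)))
         (trans (map-tabulate id _) (sym (map-tabulate suc ⁅_⁆)))) ⟩
  map ⁅_⁆ (allFin (suc n)) ∎
  where
  open PermutationReasoning
  Ss = subsets n
  P? = λ (S : Subset (suc n)) → ∣ S ∣ ≟ 1

-- The terms of the polynomial linear in x.

module _ {n} (G : Graph n) where

  v∉nbhd : ∀ v → v ∉ nbhd G v
  -- Membership in the tabulated set amounts to `does (Adj? G v v)` being `true`: a negative
  -- decision is absurd, a positive one contradicts irreflexivity.
  v∉nbhd v v∈ with Adj? G v v | trans (sym (lookup∘tabulate (λ u → does (Adj? G v u)) v)) ([]=⇒lookup v∈)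
  ... | yes e | _ = Adj-irrefl G e
  ... | no _  | ()

  nbhd⊆∁⁅v⁆ : ∀ v → nbhd G v ⊆ ∁ ⁅ v ⁆
  nbhd⊆∁⁅v⁆ v {u} u∈ = x∉p⇒x∈∁p λ u∈v →
    v∉nbhd v (subst (_∈ nbhd G v) (x∈⁅y⁆⇒x≡y v u∈v) u∈)

  score-⁅⁆ : ∀ v → score G ⁅ v ⁆ v ≡ n ∸ degree G v
  score-⁅⁆ v = trans (cong₂ (λ p q → (∣ p ∣ + n) ∸ ∣ q ∣) inner outer)
                     (cong (λ c → (c + n) ∸ degree G v) (∣⊥∣≡0 n))
    where
    inner : ⁅ v ⁆ ∩ nbhd G v ≡ ⊥
    inner = Empty-unique λ (u , u∈) → let (u∈v , u∈N) = x∈p∩q⁻ ⁅ v ⁆ (nbhd G v) u∈ in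
      v∉nbhd v (subst (_∈ nbhd G v) (x∈⁅y⁆⇒x≡y v u∈v) u∈N)

    outer : ∁ ⁅ v ⁆ ∩ nbhd G v ≡ nbhd G v
    outer = ⊆-antisym (p∩q⊆q (∁ ⁅ v ⁆) (nbhd G v)) λ u∈N → x∈p∩q⁺ (nbhd⊆∁⁅v⁆ v u∈N , u∈N)

  -- The minimum ranges over members of `⁅ v ⁆`, all equal to `v`, so every score in the list is
  -- that of `v`.
  f-y-⁅⁆ : ∀ v → f-y G ⁅ v ⁆ ≡ n ∸ degree G v
  f-y-⁅⁆ v = trans
    (minimum-constant _
      (All.map⁺ (All.map (λ u∈ → cong (score G ⁅ v ⁆) (x∈⁅y⁆⇒x≡y v u∈))
        (All.all-filter (_∈? ⁅ v ⁆) (allFin n))))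
      (∈-map⁺ (score G ⁅ v ⁆) (∈-filter⁺ (_∈? ⁅ v ⁆) (∈-allFin v) (x∈⁅x⁆ v))))
    (score-⁅⁆ v)

  connected-⁅⁆ : ∀ v → Connected (induced G ⁅ v ⁆)
  connected-⁅⁆ v (a , a∈) (b , b∈)
    with refl ← x∈⁅y⁆⇒x≡y v a∈ | refl ← x∈⁅y⁆⇒x≡y v b∈
    -- Vertices of the induced subgraph carry membership proofs, which must also coincide before the
    -- empty path fits.
    with refl ← []=-irrelevant a∈ b∈ = ε

  coeff-1-da : ∀ l →
    coeff 1 l (da G) ≡ length (filter (λ v → (n ∸ degree G v) ≟ l) (allFin n))
  coeff-1-da l = begin
    sum (map coefficient (filter T? (map term (filter Q? Ss))))
      ≡⟨ cong (sum ∘ map coefficient) (filter-map T? term (filter Q? Ss)) ⟩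
    sum (map coefficient (map term (filter (T? ∘ term) (filter Q? Ss))))
      ≡⟨ cong sum (map-∘ (filter (T? ∘ term) (filter Q? Ss))) ⟨
    sum (map (λ _ → 1) (filter (T? ∘ term) (filter Q? Ss)))
      ≡⟨ sum-map-1 (filter (T? ∘ term) (filter Q? Ss)) ⟩
    length (filter (T? ∘ term) (filter Q? Ss))
      -- The conjunction is regrouped so that the size test is applied first, where `singletons` can
      -- replace its result.
      ≡⟨ cong length (trans (filter-filter (T? ∘ term) Q? Ss)
           (trans (filter-≐ _ _ ((λ (q , s , y) → s , q , y) , (λ (s , q , y) → q , s , y)) Ss)
                  (sym (filter-filter QY? (λ S → ∣ S ∣ ≟ 1) Ss)))) ⟩
    length (filter QY? (filter (λ S → ∣ S ∣ ≟ 1) Ss))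
      ≡⟨ Perm.↭-length (Perm.filter-↭ QY? (singletons n)) ⟩
    length (filter QY? (map ⁅_⁆ (allFin n)))
      ≡⟨ trans (cong length (filter-map QY? ⁅_⁆ (allFin n))) (length-map ⁅_⁆ (filter (QY? ∘ ⁅_⁆) (allFin n))) ⟩
    length (filter (QY? ∘ ⁅_⁆) (allFin n))
      -- Every `⁅ v ⁆` is nonempty and connected, so only the condition on the y-exponent remains.
      ≡⟨ cong length (filter-≐ _ _
           ( (λ {v} (_ , y) → trans (sym (f-y-⁅⁆ v)) y)
           , (λ {v} y → ((v , x∈⁅x⁆ v) , connected-⁅⁆ v) , trans (f-y-⁅⁆ v) y)) (allFin n)) ⟩
    length (filter (λ v → (n ∸ degree G v) ≟ l) (allFin n)) ∎
    where
    open ≡-Reasoning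
    Ss   = subsets n
    term = λ S → 1 x^ ∣ S ∣ y^ f-y G S
    T?   = λ t → xExponent t ≟ 1 ×-dec yExponent t ≟ l
    Q?   = λ S → nonempty? S ×-dec connected? G S
    QY?  = λ S → Q? S ×-dec f-y G S ≟ l

  -- Degrees recovered from the coefficients.

  degree≤n : ∀ v → degree G v ≤ n
  degree≤n v = ∣p∣≤n (nbhd G v)

  numDegree≡coeff : ∀ {k} → k ≤ n → numDegree G k ≡ coeff 1 (n ∸ k) (da G)
  numDegree≡coeff {k} k≤n = trans
    (cong length (filter-≐ _ _
      -- Truncated subtraction from `n` can be cancelled because both the degree and `k` are at most
      -- `n`.
      (cong (n ∸_) , λ {v} → ∸-cancelˡ-≡ (degree≤n v) k≤n) (allFin n)))
    (sym (coeff-1-da (n ∸ k)))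

  -- The y-exponents of the terms linear in x, with repetition. The coefficients give their
  -- multiplicities directly, so two graphs can be compared before their orders are known to agree.
  codegrees : List ℕ
  codegrees = map (λ v → n ∸ degree G v) (allFin n)

  length-codegrees : length codegrees ≡ n
  length-codegrees = trans (length-map _ (allFin n)) (length-tabulate id)

  coeff-1-da-codegrees : ∀ l → coeff 1 l (da G) ≡ length (filter (_≟ l) codegrees)
  coeff-1-da-codegrees l = trans (coeff-1-da l) (sym (trans
    (cong length (filter-map (_≟ l) (λ v → n ∸ degree G v) (allFin n)))
    (length-map _ (filter (λ v → (n ∸ degree G v) ≟ l) (allFin n)))))

  degrees-from-codegrees : map (n ∸_) codegrees ≡ map (degree G) (allFin n)
  degrees-from-codegrees = trans (sym (map-∘ (allFin n)))
    (map-cong (λ v → m∸[m∸n]≡n (degree≤n v)) (allFin n))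

degreeSequence-determined : ∀ {m n} (G : Graph m) (H : Graph n) →
  da G ≈ da H → degreeSequence G ≡ degreeSequence H
degreeSequence-determined {m} {n} G H G≈H = same-order m≡n H codegrees↭
  where
  codegrees↭ : codegrees G ↭ codegrees H
  codegrees↭ = counts⇒↭ _≟_ _ _ λ l → trans (sym (coeff-1-da-codegrees G l))
    (trans (G≈H 1 l) (coeff-1-da-codegrees H l))

  m≡n : m ≡ n
  m≡n = trans (sym (length-codegrees G))
    (trans (Perm.↭-length codegrees↭) (length-codegrees H))

  -- The second order is a fresh variable, so that matching on `refl` can identify it with `m`; then
  -- the same map `m ∸_` turns both codegree lists into degree lists.
  same-order : ∀ {n} → m ≡ n → (H : Graph n) → codegrees G ↭ codegrees H →
    degreeSequence G ≡ degreeSequence H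
  same-order refl H p = sort-cong (↭-trans (↭-reflexive (sym (degrees-from-codegrees G)))
    (↭-trans (Perm.map⁺ (m ∸_) p) (↭-reflexive (degrees-from-codegrees H))))

proposition12 : (∀ (n : ℕ) .{{_ : NonZero n}} (G : Graph n) (k : ℕ) → k < n →
    numDegree G k ≡ coeff 1 (n ∸ k) (da G))
    ×
    (∀ (m n : ℕ) .{{_ : NonZero m}} .{{_ : NonZero n}} (G : Graph m) (H : Graph n) →
    da G ≈ da H → degreeSequence G ≡ degreeSequence H)
proposition12 = (λ _ G _ k<n → numDegree≡coeff G (<⇒≤ k<n))
              , (λ _ _ G H → degreeSequence-determined G H)
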